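{- For every Korselt number ($KN$) $n$, $$n\le \tfrac12\left(P^6+2P^5-P^4-P^3+2P^2-P\right),$$ with equality if and only if $q=P^2+P-1$ and $r=\frac12(P-1)(P+1)^2+1$.
   Context: A Korselt number ($KN$) is an integer $n$ together with a factorisation $n=\prod_{i=1}^d p_i$, where $d\ge 3$ and $1<p_1<p_2<\dots<p_d$ are odd integers (not necessarily prime), such that $p_i-1$ divides $n-1$ for every $i$, and such that $E:=\dfrac{n/p_d-1}{p_d-1}$ (which is an integer by the divisibility condition) satisfies $E\ge 2$. Notation: $P:=\prod_{i=1}^{d-2}p_i$, $q:=p_{d-1}$, $r:=p_d$, so that $n=Pqr$. -}

module Defs where

open import Data.Fin.Base using (Fin) renaming (_<_ to _<ᶠ_)
open import Data.Nat.Base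
  using (ℕ; suc; _+_; _*_; _∸_; _/_; _≤_; _<_; NonZero; >-nonZero)
open import Data.Nat.Divisibility using (_∣_)
open import Data.Nat.Properties using (<-trans; m<n⇒0<n∸m; n<1+n)
open import Data.Vec.Functional using (Vector; foldr; init; last)
open import Relation.Binary.PropositionalEquality using (_≡_)
open import Relation.Nullary.Negation using (¬_)

∏ : ∀ {k} → Vector ℕ k → ℕ
∏ = foldr _*_ 1

-- Every subtraction _∸_ below is a genuine one: p i > 1, and hence all
-- the numbers from which 1 is subtracted are positive.
record KorseltNumber (n : ℕ) : Set where
  field
    -- The number of factors is d = 3 + m, which says exactly that d ≥ 3.
    m : ℕ

  d : ℕ
  d = suc (suc (suc m))

  field
    p            : Vector ℕ d
    n≡∏p         : n ≡ ∏ p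
    p>1          : ∀ i → 1 < p i
    p-increasing : ∀ {i j} → i <ᶠ j → p i < p j
    p-odd        : ∀ i → ¬ (2 ∣ p i)
    p-1∣n-1      : ∀ i → p i ∸ 1 ∣ n ∸ 1

  P : ℕ
  P = ∏ (init (init p))

  q : ℕ
  q = last (init p)

  r : ℕ
  r = last p

  private
    instance
      r-nonZero : NonZero r
      r-nonZero = >-nonZero (<-trans (n<1+n 0) (p>1 _))

      r-1-nonZero : NonZero (r ∸ 1)
      r-1-nonZero = >-nonZero (m<n⇒0<n∸m (p>1 _))

  -- Both divisions are exact: r is a factor of n, and
  -- n - 1 = (n / r) (r - 1) + (n / r - 1) is divisible by r - 1.
  E : ℕ
  E = (n / r ∸ 1) / (r ∸ 1)

  field
    E≥2 : 2 ≤ E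

{-# OPTIONS --safe #-}
module Submission where

-- Put x = P - 1, a = q - 1, b = r - 1.  The divisibilities r - 1 ∣ n - 1 and
-- q - 1 ∣ n - 1 say that P a + x = E b and P b + x = D a.  Eliminating, with
-- C = D E - P², one gets C a = x (P + E) and C b = x (P + D), so C ≥ 1, and
-- D > P ≥ 2 because b > a.  From (D - 2) (E - 2) ≥ 0 it follows that
-- 2 (D + E) ≤ P² + C + 4, and then both a + b and a b are at most their values
-- at E = 2, C = 1.  In the bound on a + b the deficit is a combination of
-- (D - 2) (E - 2) and C - 1, and D > 2, so equality forces E = 2 and C = 1.

open import Defs
open import Data.Fin.Base using (fromℕ; inject₁) renaming (zero to fzero; suc to fsuc)
import Data.Fin.Properties as Finₚ
open import Data.List.Base using ([]; _∷_)
open import Data.Nat.Base as ℕ using (ℕ; zero; suc)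
open import Data.Nat.Divisibility using (_∣_; quotient; ∣m+n∣m⇒∣n; n∣m*n)
open import Data.Nat.DivMod using (m*n/n≡m; m/n*n≡m)
open import Data.Nat.Properties
open import Data.Nat.Tactic.RingSolver as ℕ-Solver using ()
import Data.Integer.Properties as ℤₚ
open import Data.Integer.Tactic.RingSolver as ℤ-Solver using ()
import Data.Rational.Properties as ℚₚ
open import Data.Rational.Unnormalised.Base as ℚᵘ using (mkℚᵘ; _≃_; *≡*; *≤*)
import Data.Rational.Unnormalised.Properties as ℚᵘₚ
open import Data.Product.Base using (_×_; _,_; map)
open import Data.Sum.Base using (inj₁; inj₂)
open import Data.Vec.Functional using (Vector; init; last; tail)
open import Function.Base using (_∘_)
open import Function.Bundles using (_⇔_; mk⇔)
open import Relation.Binary.PropositionalEquality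
  using (_≡_; refl; sym; trans; cong; cong₂; subst; subst₂; module ≡-Reasoning)
open import Relation.Nullary.Negation using (contradiction)

-- Arithmetic in the natural numbers.

module _ where
  open import Data.Nat.Base using (_+_; _*_; _∸_; _≤_; _<_; NonZero)

  -- With the deficit `s` explicit, an inequality is reduced to a subtraction-free identity, which
  -- the ring solver can help to check; the factor `k` clears the denominators `C` and `C²`.
  *-slack⇒≤ : ∀ k {u v s} .{{_ : NonZero k}} → k * u + s ≡ k * v → u ≤ v
  *-slack⇒≤ k {s = s} eq = *-cancelˡ-≤ k (≤-trans (m≤m+n _ s) (≤-reflexive eq))

  *-slack-≡⇒≡0 : ∀ k {u v s} → k * u + s ≡ k * v → u ≡ v → s ≡ 0
  *-slack-≡⇒≡0 k {u} eq refl = +-cancelˡ-≡ (k * u) _ 0 (trans eq (sym (+-identityʳ _)))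

  ≤∧+-≡⇒≡ : ∀ {u u′ v v′} → u ≤ u′ → v ≤ v′ → u + v ≡ u′ + v′ → v ≡ v′
  ≤∧+-≡⇒≡ u≤u′ v≤v′ eq with m≤n⇒m<n∨m≡n v≤v′
  ... | inj₂ v≡v′ = v≡v′
  ... | inj₁ v<v′ = contradiction eq (<⇒≢ (+-mono-≤-< u≤u′ v<v′))

  -- Elimination from the two divisor equations.

  module Elimination {x P a b D E : ℕ} (Pa+x≡Eb : P * a + x ≡ E * b) (Pb+x≡Da : P * b + x ≡ D * a) where

    DEa≡P²a+xP+xE : D * E * a ≡ P * P * a + x * (P + E)
    DEa≡P²a+xP+xE = begin
      D * E * a                 ≡⟨ ℕ-Solver.solve (D ∷ E ∷ a ∷ []) ⟩
      E * (D * a)               ≡⟨ cong (E *_) Pb+x≡Da ⟨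
      E * (P * b + x)           ≡⟨ ℕ-Solver.solve (E ∷ P ∷ b ∷ x ∷ []) ⟩
      P * (E * b) + E * x       ≡⟨ cong (λ z → P * z + E * x) Pa+x≡Eb ⟨
      P * (P * a + x) + E * x   ≡⟨ ℕ-Solver.solve (E ∷ P ∷ a ∷ x ∷ []) ⟩
      P * P * a + x * (P + E)   ∎
      where open ≡-Reasoning

    Ca≡xP+xE : ∀ {C} → D * E ≡ P * P + C → C * a ≡ x * (P + E)
    Ca≡xP+xE {C} DE≡P²+C = +-cancelˡ-≡ (P * P * a) _ _ (begin
      P * P * a + C * a         ≡⟨ *-distribʳ-+ a (P * P) C ⟨
      (P * P + C) * a           ≡⟨ cong (_* a) DE≡P²+C ⟨
      D * E * a                 ≡⟨ DEa≡P²a+xP+xE ⟩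
      P * P * a + x * (P + E)   ∎)
      where open ≡-Reasoning

    P²<DE : 0 < x → 0 < P → P * P < D * E
    P²<DE 0<x 0<P = *-cancelʳ-< a _ _ (begin-strict
      P * P * a                 <⟨ m<m+n _ (*-mono-< 0<x (≤-trans 0<P (m≤m+n P E))) ⟩
      P * P * a + x * (P + E)   ≡⟨ DEa≡P²a+xP+xE ⟨
      D * E * a                 ∎)
      where open ≤-Reasoning

    P<D : 0 < x → a < b → P < D
    P<D 0<x a<b = *-cancelʳ-< a _ _ (begin-strict
      P * a       ≤⟨ *-monoʳ-≤ P (<⇒≤ a<b) ⟩
      P * b       <⟨ m<m+n _ 0<x ⟩
      P * b + x   ≡⟨ Pb+x≡Da ⟩
      D * a       ∎)
      where open ≤-Reasoning

  -- Bounds on `a + b` and `a * b` with explicit deficits.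

  module Bounds {x P a b e f c : ℕ}
    (DE≡P²+C : (2 + f) * (2 + e) ≡ P * P + (1 + c))
    (Ca≡xP+xE : (1 + c) * a ≡ x * (P + (2 + e)))
    (Cb≡xP+xD : (1 + c) * b ≡ x * (P + (2 + f)))
    where

    -- Here D = 2 + f, E = 2 + e and C = 1 + c, so the lower bounds on D, E and C are built into
    -- their form, and `e * f` is the product (D - 2) (E - 2), which expands to D E + 4 - 2 (D + E).
    2[D+E]+ef≡P²+C+4 : 2 * ((2 + f) + (2 + e)) + e * f ≡ P * P + (1 + c) + 4
    2[D+E]+ef≡P²+C+4 = trans (regroup e f) (cong (_+ 4) DE≡P²+C)
      where
      regroup : ∀ e f → 2 * ((2 + f) + (2 + e)) + e * f ≡ (2 + f) * (2 + e) + 4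
      regroup = ℕ-Solver.solve-∀

    -- By the previous identity, 2 C (a + b) + x e f = x ((P + 2)² + C). The term with factor `c`
    -- raises the coefficient of (P + 2)² from 1 to C, after which C factors out.
    sum-slack : (1 + c) * (2 * (a + b)) + (x * (e * f) + c * (x * ((P + 2) * (P + 2))))
              ≡ (1 + c) * (x * ((P + 2) * (P + 2) + 1))
    sum-slack = begin
      (1 + c) * (2 * (a + b)) + (x * (e * f) + c * (x * ((P + 2) * (P + 2))))
        ≡⟨ ℕ-Solver.solve (x ∷ P ∷ a ∷ b ∷ e ∷ f ∷ c ∷ []) ⟩
      2 * ((1 + c) * a + (1 + c) * b) + (x * (e * f) + c * (x * ((P + 2) * (P + 2))))
        ≡⟨ cong₂ (λ u v → 2 * (u + v) + (x * (e * f) + c * (x * ((P + 2) * (P + 2))))) Ca≡xP+xE Cb≡xP+xD ⟩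
      2 * (x * (P + (2 + e)) + x * (P + (2 + f))) + (x * (e * f) + c * (x * ((P + 2) * (P + 2))))
        ≡⟨ ℕ-Solver.solve (x ∷ P ∷ e ∷ f ∷ c ∷ []) ⟩
      x * (4 * P + (2 * ((2 + f) + (2 + e)) + e * f)) + c * (x * ((P + 2) * (P + 2)))
        ≡⟨ cong (λ u → x * (4 * P + u) + c * (x * ((P + 2) * (P + 2)))) 2[D+E]+ef≡P²+C+4 ⟩
      x * (4 * P + (P * P + (1 + c) + 4)) + c * (x * ((P + 2) * (P + 2)))
        ≡⟨ ℕ-Solver.solve (x ∷ P ∷ c ∷ []) ⟩
      (1 + c) * (x * ((P + 2) * (P + 2) + 1)) ∎
      where open ≡-Reasoning

    -- Likewise 2 C² a b + x² P e f = x² (P (P + 2)² + C (P + 2)). Since (P + 1)² = P (P + 2) + 1,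
    -- the target is C² x² (P (P + 2)² + (P + 2)), and the remaining deficits carry the factors C² -
    -- 1 = 2 c + c² and C² - C = (1 + c) c.
    product-slack :
      (1 + c) * (1 + c) * (2 * (a * b))
        + x * x * (P * (e * f) + ((2 * c + c * c) * (P * ((P + 2) * (P + 2))) + (1 + c) * c * (P + 2)))
      ≡ (1 + c) * (1 + c) * (x * (P + 2) * (x * ((P + 1) * (P + 1))))
    product-slack = begin
      (1 + c) * (1 + c) * (2 * (a * b)) + x * x * (P * (e * f) + s)
        ≡⟨ lhs a b c x P (e * f) s ⟩
      2 * (((1 + c) * a) * ((1 + c) * b)) + x * x * (P * (e * f) + s)
        ≡⟨ cong₂ (λ u v → 2 * (u * v) + x * x * (P * (e * f) + s)) Ca≡xP+xE Cb≡xP+xD ⟩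
      2 * (x * (P + (2 + e)) * (x * (P + (2 + f)))) + x * x * (P * (e * f) + s)
        ≡⟨ mid x P e f s ⟩
      x * x * (2 * (P * P) + P * (2 * ((2 + f) + (2 + e)) + e * f) + 2 * ((2 + f) * (2 + e)) + s)
        ≡⟨ cong₂ (λ u v → x * x * (2 * (P * P) + P * u + 2 * v + s)) 2[D+E]+ef≡P²+C+4 DE≡P²+C ⟩
      x * x * (2 * (P * P) + P * (P * P + (1 + c) + 4) + 2 * (P * P + (1 + c)) + s)
        ≡⟨ rhs x P c ⟩
      (1 + c) * (1 + c) * (x * (P + 2) * (x * ((P + 1) * (P + 1)))) ∎
      where
      open ≡-Reasoning
      s = (2 * c + c * c) * (P * ((P + 2) * (P + 2))) + (1 + c) * c * (P + 2)
      lhs : ∀ a b c x P t s → (1 + c) * (1 + c) * (2 * (a * b)) + x * x * (P * t + s)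
                            ≡ 2 * (((1 + c) * a) * ((1 + c) * b)) + x * x * (P * t + s)
      lhs = ℕ-Solver.solve-∀
      mid : ∀ x P e f s →
        2 * (x * (P + (2 + e)) * (x * (P + (2 + f)))) + x * x * (P * (e * f) + s)
        ≡ x * x * (2 * (P * P) + P * (2 * ((2 + f) + (2 + e)) + e * f) + 2 * ((2 + f) * (2 + e)) + s)
      mid = ℕ-Solver.solve-∀
      rhs : ∀ x P c →
        x * x * (2 * (P * P) + P * (P * P + (1 + c) + 4) + 2 * (P * P + (1 + c))
          + ((2 * c + c * c) * (P * ((P + 2) * (P + 2))) + (1 + c) * c * (P + 2)))
        ≡ (1 + c) * (1 + c) * (x * (P + 2) * (x * ((P + 1) * (P + 1))))
      rhs = ℕ-Solver.solve-∀

    sum-≤ : 2 * (a + b) ≤ x * ((P + 2) * (P + 2) + 1)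
    sum-≤ = *-slack⇒≤ (1 + c) sum-slack

    product-≤ : 2 * (a * b) ≤ x * (P + 2) * (x * ((P + 1) * (P + 1)))
    product-≤ = *-slack⇒≤ ((1 + c) * (1 + c)) product-slack

    sum-≡⇒ : 0 < x → 0 < P → 0 < f → 2 * (a + b) ≡ x * ((P + 2) * (P + 2) + 1) →
             a ≡ x * (P + 2) × 2 * b ≡ x * ((P + 1) * (P + 1))
    sum-≡⇒ 0<x 0<P 0<f eq = a≡ , 2b≡
      where
      instance
        _ = ℕ.>-nonZero 0<x
        _ = ℕ.>-nonZero 0<P
        _ = ℕ.>-nonZero 0<f
      slack≡0 : x * (e * f) + c * (x * ((P + 2) * (P + 2))) ≡ 0
      slack≡0 = *-slack-≡⇒≡0 (1 + c) sum-slack eq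
      e≡0 : e ≡ 0
      e≡0 = m*n≡0⇒m≡0 e f (m*n≡0⇒m≡0 (e * f) x
              (trans (*-comm (e * f) x) (m+n≡0⇒m≡0 _ slack≡0)))
      c≡0 : c ≡ 0
      c≡0 = m*n≡0⇒m≡0 c (x * ((P + 2) * (P + 2))) {{nz}} (m+n≡0⇒n≡0 (x * (e * f)) slack≡0)
        where
        nz : NonZero (x * ((P + 2) * (P + 2)))
        nz = ℕ.>-nonZero (*-mono-< 0<x (*-mono-< (<-≤-trans 0<P (m≤m+n P 2)) (<-≤-trans 0<P (m≤m+n P 2))))
      a≡ : a ≡ x * (P + 2)
      a≡ = begin
        a                   ≡⟨ *-identityˡ a ⟨
        1 * a               ≡⟨ cong (λ z → (1 + z) * a) c≡0 ⟨
        (1 + c) * a         ≡⟨ Ca≡xP+xE ⟩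
        x * (P + (2 + e))   ≡⟨ cong (λ z → x * (P + (2 + z))) e≡0 ⟩
        x * (P + 2)         ∎
        where open ≡-Reasoning
      -- Subtracting `a` from the known sum avoids solving for D, which would be (P² + 1) / 2.
      2b≡ : 2 * b ≡ x * ((P + 1) * (P + 1))
      2b≡ = +-cancelˡ-≡ (2 * (x * (P + 2))) _ _ (begin
        2 * (x * (P + 2)) + 2 * b                      ≡⟨ cong (λ z → 2 * z + 2 * b) a≡ ⟨
        2 * a + 2 * b                                  ≡⟨ *-distribˡ-+ 2 a b ⟨
        2 * (a + b)                                    ≡⟨ eq ⟩
        x * ((P + 2) * (P + 2) + 1)                    ≡⟨ ℕ-Solver.solve (x ∷ P ∷ []) ⟩
        2 * (x * (P + 2)) + x * ((P + 1) * (P + 1))    ∎)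
        where open ≡-Reasoning

  -- Twice the value of n = P (1 + a) (1 + b) at E = 2, C = 1.
  maximum : ℕ → ℕ → ℕ
  maximum x P = P * (1 + x * (P + 2)) * (2 + x * ((P + 1) * (P + 1)))

  maximum-expand : ∀ x P → maximum x P
    ≡ P * (x * (P + 2) * (x * ((P + 1) * (P + 1))) + x * ((P + 2) * (P + 2) + 1) + 2)
  maximum-expand = expand
    where
    expand : ∀ x P → P * (1 + x * (P + 2)) * (2 + x * ((P + 1) * (P + 1)))
      ≡ P * (x * (P + 2) * (x * ((P + 1) * (P + 1))) + x * ((P + 2) * (P + 2) + 1) + 2)
    expand = ℕ-Solver.solve-∀

  -- The right-hand side is increasing in `a * b` and in `a + b`, so the two bounds may be inserted
  -- separately.
  2P[1+a][1+b]-expand : ∀ P a b →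
    2 * (P * (1 + a) * (1 + b)) ≡ P * (2 * (a * b) + 2 * (a + b) + 2)
  2P[1+a][1+b]-expand = ℕ-Solver.solve-∀

  -- The bound and its equality case in terms of `a` and `b`.

  module Pair {x P a b D E : ℕ} (0<x : 0 < x) (1<P : 1 < P) (a<b : a < b) (2≤E : 2 ≤ E)
    (Pa+x≡Eb : P * a + x ≡ E * b) (Pb+x≡Da : P * b + x ≡ D * a) where

    private
      module R = Elimination {x} {P} {a} {b} {D} {E} Pa+x≡Eb Pb+x≡Da
      -- The pair of equations is invariant under exchanging `a` with `b` and `D` with `E`, so the
      -- same elimination also yields `b`.
      module Q = Elimination {x} {P} {b} {a} {E} {D} Pb+x≡Da Pa+x≡Eb

      0<P : 0 < P
      0<P = <⇒≤ 1<P

      -- Strictness makes `f` positive, which the equality case needs in order to conclude e = 0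
      -- from e f = 0.
      2<D : 2 < D
      2<D = ≤-<-trans 1<P (R.P<D 0<x a<b)

      e f c : ℕ
      e = E ∸ 2
      f = D ∸ 2
      -- The subtraction is not truncated, because `P²<DE`.
      c = D * E ∸ suc (P * P)

      E≡2+e : E ≡ 2 + e
      E≡2+e = sym (m+[n∸m]≡n 2≤E)

      D≡2+f : D ≡ 2 + f
      D≡2+f = sym (m+[n∸m]≡n (<⇒≤ 2<D))

      DE≡P²+C : D * E ≡ P * P + (1 + c)
      DE≡P²+C = trans (sym (m+[n∸m]≡n (R.P²<DE 0<x 0<P))) (sym (+-suc (P * P) c))

      Ca : (1 + c) * a ≡ x * (P + E)
      Ca = R.Ca≡xP+xE DE≡P²+C

      Cb : (1 + c) * b ≡ x * (P + D)
      Cb = Q.Ca≡xP+xE (trans (*-comm E D) DE≡P²+C)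

      module B = Bounds {x} {P} {a} {b} {e} {f} {c}
        (subst₂ (λ u v → u * v ≡ P * P + (1 + c)) D≡2+f E≡2+e DE≡P²+C)
        (subst (λ u → (1 + c) * a ≡ x * (P + u)) E≡2+e Ca)
        (subst (λ u → (1 + c) * b ≡ x * (P + u)) D≡2+f Cb)

    n-≤ : 2 * (P * (1 + a) * (1 + b)) ≤ maximum x P
    n-≤ = begin
      2 * (P * (1 + a) * (1 + b))              ≡⟨ 2P[1+a][1+b]-expand P a b ⟩
      P * (2 * (a * b) + 2 * (a + b) + 2)      ≤⟨ *-monoʳ-≤ P (+-monoˡ-≤ 2 (+-mono-≤ B.product-≤ B.sum-≤)) ⟩
      P * (x * (P + 2) * (x * ((P + 1) * (P + 1))) + x * ((P + 2) * (P + 2) + 1) + 2)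
                                               ≡⟨ maximum-expand x P ⟨
      maximum x P                              ∎
      where open ≤-Reasoning

    n-≡⇒ : 2 * (P * (1 + a) * (1 + b)) ≡ maximum x P →
           a ≡ x * (P + 2) × 2 * b ≡ x * ((P + 1) * (P + 1))
    -- When the total is attained, each of the two bounds is attained; the one on the sum already
    -- determines `a` and `b`.
    n-≡⇒ eq = B.sum-≡⇒ 0<x 0<P (m<n⇒0<n∸m 2<D) (≤∧+-≡⇒≡ B.product-≤ B.sum-≤ total-≡)
      where
      total-≡ : 2 * (a * b) + 2 * (a + b)
              ≡ x * (P + 2) * (x * ((P + 1) * (P + 1))) + x * ((P + 2) * (P + 2) + 1)
      total-≡ = +-cancelʳ-≡ 2 _ _ (*-cancelˡ-≡ _ _ P {{ℕ.>-nonZero 0<P}}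
        (trans (sym (2P[1+a][1+b]-expand P a b)) (trans eq (maximum-expand x P))))

  n-≡⇐ : ∀ {x P a b} → a ≡ x * (P + 2) → 2 * b ≡ x * ((P + 1) * (P + 1)) →
         2 * (P * (1 + a) * (1 + b)) ≡ maximum x P
  n-≡⇐ {x} {P} {a} {b} refl 2b≡ = trans (regroup (P * (1 + a)) b) (cong (λ z → P * (1 + a) * (2 + z)) 2b≡)
    where
    regroup : ∀ k b → 2 * (k * (1 + b)) ≡ k * (2 + 2 * b)
    regroup = ℕ-Solver.solve-∀

  -- Return from `a` and `b` to `q` and `r`.

  m[n∸1]+[m∸1]≡mn∸1 : ∀ {m n} → 0 < m → 0 < n → m * (n ∸ 1) + (m ∸ 1) ≡ m * n ∸ 1
  m[n∸1]+[m∸1]≡mn∸1 {suc m} {suc n} _ _ = regroup m n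
    where
    regroup : ∀ m n → (1 + m) * n + m ≡ n + m * (1 + n)
    regroup = ℕ-Solver.solve-∀

  module Extremal {n P q r D E : ℕ} (n≡Pqr : n ≡ P * q * r)
    (P>1 : 1 < P) (q>1 : 1 < q) (q<r : q < r) (E≥2 : 2 ≤ E)
    (E*[r∸1]≡Pq∸1 : E * (r ∸ 1) ≡ P * q ∸ 1) (D*[q∸1]≡Pr∸1 : D * (q ∸ 1) ≡ P * r ∸ 1) where

    private
      r>1 : 1 < r
      r>1 = <-trans q>1 q<r

      1+[q∸1]≡q : 1 + (q ∸ 1) ≡ q
      1+[q∸1]≡q = m+[n∸m]≡n (<⇒≤ q>1)

      1+[r∸1]≡r : 1 + (r ∸ 1) ≡ r
      1+[r∸1]≡r = m+[n∸m]≡n (<⇒≤ r>1)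

      2Pqr≡2n : 2 * (P * (1 + (q ∸ 1)) * (1 + (r ∸ 1))) ≡ 2 * n
      2Pqr≡2n = cong (2 *_) (trans (cong₂ (λ u v → P * u * v) 1+[q∸1]≡q 1+[r∸1]≡r) (sym n≡Pqr))

      Pa+x≡Eb : P * (q ∸ 1) + (P ∸ 1) ≡ E * (r ∸ 1)
      Pa+x≡Eb = trans (m[n∸1]+[m∸1]≡mn∸1 (<⇒≤ P>1) (<⇒≤ q>1)) (sym E*[r∸1]≡Pq∸1)

      Pb+x≡Da : P * (r ∸ 1) + (P ∸ 1) ≡ D * (q ∸ 1)
      Pb+x≡Da = trans (m[n∸1]+[m∸1]≡mn∸1 (<⇒≤ P>1) (<⇒≤ r>1)) (sym D*[q∸1]≡Pr∸1)

      P∸1>0 : 0 < P ∸ 1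
      P∸1>0 = m<n⇒0<n∸m P>1

      q∸1<r∸1 : q ∸ 1 < r ∸ 1
      q∸1<r∸1 = ∸-monoˡ-< q<r (<⇒≤ q>1)

      module M = Pair {P ∸ 1} {P} {q ∸ 1} {r ∸ 1} {D} {E} P∸1>0 P>1 q∸1<r∸1 E≥2 Pa+x≡Eb Pb+x≡Da

    2n≤maximum : 2 * n ≤ maximum (P ∸ 1) P
    2n≤maximum = subst (_≤ maximum (P ∸ 1) P) 2Pqr≡2n M.n-≤

    2n≡maximum⇒ : 2 * n ≡ maximum (P ∸ 1) P →
      q ≡ 1 + (P ∸ 1) * (P + 2) × 2 * r ≡ 2 + (P ∸ 1) * ((P + 1) * (P + 1))
    2n≡maximum⇒ eq = map
      (λ a≡ → trans (sym 1+[q∸1]≡q) (cong (1 +_) a≡))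
      (λ 2b≡ → trans (cong (2 *_) (sym 1+[r∸1]≡r)) (trans (*-distribˡ-+ 2 1 (r ∸ 1)) (cong (2 +_) 2b≡)))
      (M.n-≡⇒ (trans 2Pqr≡2n eq))

    2n≡maximum⇐ : q ≡ 1 + (P ∸ 1) * (P + 2) → 2 * r ≡ 2 + (P ∸ 1) * ((P + 1) * (P + 1)) →
      2 * n ≡ maximum (P ∸ 1) P
    2n≡maximum⇐ q≡ 2r≡ = trans (sym 2Pqr≡2n) (n-≡⇐ {P ∸ 1} {P} {q ∸ 1} {r ∸ 1} (cong (_∸ 1) q≡)
      (trans (*-distribˡ-∸ 2 r 1) (cong (_∸ 2) 2r≡)))

  -- Products of vectors and the data of a Korselt number.

  ∏-init-last : ∀ {k} (v : Vector ℕ (suc k)) → ∏ v ≡ ∏ (init v) * last v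
  ∏-init-last {zero}  v = *-comm (v fzero) 1
  ∏-init-last {suc k} v = trans (cong (v fzero *_) (∏-init-last (tail v)))
                                (sym (*-assoc (v fzero) _ _))

  ∏-positive : ∀ {k} (v : Vector ℕ k) → (∀ i → 0 < v i) → 0 < ∏ v
  ∏-positive {zero}  v v>0 = ≤-refl
  ∏-positive {suc k} v v>0 = *-mono-< (v>0 fzero) (∏-positive (tail v) (v>0 ∘ fsuc))

  ∏>1 : ∀ {k} (v : Vector ℕ (suc k)) → (∀ i → 1 < v i) → 1 < ∏ v
  ∏>1 v v>1 = *-mono-≤ (v>1 fzero) (∏-positive (tail v) (<⇒≤ ∘ v>1 ∘ fsuc))

  -- Modulo `k` the factor `1 + k` is 1. It is used with 1 + k equal to `r` or `q`, to pass from
  -- `n ∸ 1` to the cofactor minus one.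
  k∣m[1+k]∸1 : ∀ {k} m → 0 < m → k ∣ m * (1 + k) ∸ 1 → k ∣ m ∸ 1
  k∣m[1+k]∸1 {k} (suc m) _ k∣ =
    ∣m+n∣m⇒∣n (subst (k ∣_) (trans (+-comm k (m * suc k)) (regroup m k)) k∣) (n∣m*n (suc m))
    where
    regroup : ∀ m k → m * (1 + k) + k ≡ (1 + m) * k + m
    regroup = ℕ-Solver.solve-∀

  module _ {n : ℕ} (K : KorseltNumber n) where
    open KorseltNumber K using (m; p; p>1; P; q; r; E)

    n≡Pqr : n ≡ P * q * r
    n≡Pqr = trans (KorseltNumber.n≡∏p K)
      (trans (∏-init-last p) (cong (_* r) (∏-init-last (init p))))

    -- The condition d ≥ 3 enters here: `P` has 1 + m factors and is not an empty product.
    P>1 : 1 < P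
    P>1 = ∏>1 (init (init p)) (λ i → p>1 (inject₁ (inject₁ i)))

    q>1 : 1 < q
    q>1 = p>1 (inject₁ (fromℕ (suc m)))

    r>1 : 1 < r
    r>1 = p>1 (fromℕ (suc (suc m)))

    q<r : q < r
    q<r = KorseltNumber.p-increasing K
      (subst₂ _<_ (sym (trans (Finₚ.toℕ-inject₁ _) (Finₚ.toℕ-fromℕ _))) (sym (Finₚ.toℕ-fromℕ _)) (n<1+n _))

    r∸1∣Pq∸1 : r ∸ 1 ∣ P * q ∸ 1
    r∸1∣Pq∸1 = k∣m[1+k]∸1 (P * q) (*-mono-< (<⇒≤ P>1) (<⇒≤ q>1))
      (subst (λ z → r ∸ 1 ∣ z ∸ 1) (trans n≡Pqr (cong (P * q *_) (sym (m+[n∸m]≡n (<⇒≤ r>1)))))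
        (KorseltNumber.p-1∣n-1 K (fromℕ (suc (suc m)))))

    q∸1∣Pr∸1 : q ∸ 1 ∣ P * r ∸ 1
    q∸1∣Pr∸1 = k∣m[1+k]∸1 (P * r) (*-mono-< (<⇒≤ P>1) (<⇒≤ r>1))
      (subst (λ z → q ∸ 1 ∣ z ∸ 1)
        -- The factors are reordered as `P * r * q`, so that `q` stands last.
        (trans n≡Pqr (trans (trans (*-assoc P q r) (trans (cong (P *_) (*-comm q r)) (sym (*-assoc P r q))))
          (cong (P * r *_) (sym (m+[n∸m]≡n (<⇒≤ q>1))))))
        (KorseltNumber.p-1∣n-1 K (inject₁ (fromℕ (suc m)))))

    -- Both floor divisions in `E` are exact: n / r is `P * q`, and `r ∸ 1` divides `P * q ∸ 1`.
    E*[r∸1]≡Pq∸1 : E * (r ∸ 1) ≡ P * q ∸ 1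
    E*[r∸1]≡Pq∸1 = trans
      (cong (λ z → (z ∸ 1) ℕ./ (r ∸ 1) * (r ∸ 1)) (trans (cong (ℕ._/ r) n≡Pqr) (m*n/n≡m (P * q) r)))
      (m/n*n≡m r∸1∣Pq∸1)
      where
      instance
        r≢0 : NonZero r
        r≢0 = ℕ.>-nonZero (<⇒≤ r>1)
        r∸1≢0 : NonZero (r ∸ 1)
        r∸1≢0 = ℕ.>-nonZero (m<n⇒0<n∸m r>1)

    open Extremal {n} {P} {q} {r} {quotient q∸1∣Pr∸1} {E}
      n≡Pqr P>1 q>1 q<r (KorseltNumber.E≥2 K) E*[r∸1]≡Pq∸1 (sym (_∣_.equality q∸1∣Pr∸1)) public

-- Passage to integers and rationals.

open import Data.Integer.Base as ℤ using (ℤ; +_; _+_; _-_; _*_; _^_; 1ℤ)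
open import Data.Rational.Base as ℚ using (ℚ; ½; _/_)

½ℤ : ℤ → ℚ
½ℤ i = ½ ℚ.* (i / 1)

-- The second argument of `mkℚᵘ` is the denominator minus one, so `mkℚᵘ i 1` is i / 2. Over this
-- common denominator, order and equality of halves reduce to those of the numerators.
toℚᵘ-½ℤ : ∀ i → ℚ.toℚᵘ (½ℤ i) ≃ mkℚᵘ i 1
toℚᵘ-½ℤ i = begin
  ℚ.toℚᵘ (½ℤ i)                       ≈⟨ ℚₚ.toℚᵘ-homo-* ½ (i / 1) ⟩
  ℚ.toℚᵘ ½ ℚᵘ.* ℚ.toℚᵘ (i / 1)        ≈⟨ ℚᵘₚ.*-congˡ {ℚ.toℚᵘ ½} (ℚₚ.toℚᵘ-fromℚᵘ (mkℚᵘ i 0)) ⟩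
  mkℚᵘ (1ℤ * i) 1                     ≡⟨ cong (λ j → mkℚᵘ j 1) (ℤₚ.*-identityˡ i) ⟩
  mkℚᵘ i 1                            ∎
  where open import Relation.Binary.Reasoning.Setoid ℚᵘₚ.≃-setoid

½ℤ-mono-≤ : ∀ {i j} → i ℤ.≤ j → ½ℤ i ℚ.≤ ½ℤ j
½ℤ-mono-≤ {i} {j} i≤j = ℚₚ.toℚᵘ-cancel-≤ (begin
  ℚ.toℚᵘ (½ℤ i)   ≃⟨ toℚᵘ-½ℤ i ⟩
  mkℚᵘ i 1        ≤⟨ *≤* (ℤₚ.*-monoʳ-≤-nonNeg (+ 2) i≤j) ⟩
  mkℚᵘ j 1        ≃⟨ toℚᵘ-½ℤ j ⟨
  ℚ.toℚᵘ (½ℤ j)   ∎)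
  where open ℚᵘₚ.≤-Reasoning

½ℤ-injective : ∀ {i j} → ½ℤ i ≡ ½ℤ j → i ≡ j
½ℤ-injective {i} {j} eq
  with *≡* 2i≡2j ← ℚᵘₚ.≃-trans (ℚᵘₚ.≃-sym (toℚᵘ-½ℤ i)) (ℚᵘₚ.≃-trans (ℚₚ.toℚᵘ-cong eq) (toℚᵘ-½ℤ j))
  = ℤₚ.*-cancelʳ-≡ i j (+ 2) 2i≡2j

½ℤ-double : ∀ n → ½ℤ (+ (2 ℕ.* n)) ≡ + n / 1
½ℤ-double n = ℚₚ.toℚᵘ-injective (begin
  ℚ.toℚᵘ (½ℤ (+ (2 ℕ.* n)))   ≈⟨ toℚᵘ-½ℤ _ ⟩
  mkℚᵘ (+ (2 ℕ.* n)) 1        ≈⟨ *≡* (trans (ℤₚ.*-identityʳ _) (trans (ℤₚ.pos-* 2 n) (ℤₚ.*-comm (+ 2) (+ n)))) ⟩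
  mkℚᵘ (+ n) 0                ≈⟨ ℚₚ.toℚᵘ-fromℚᵘ (mkℚᵘ (+ n) 0) ⟨
  ℚ.toℚᵘ (+ n / 1)            ∎)
  where open import Relation.Binary.Reasoning.Setoid ℚᵘₚ.≃-setoid

-- Absorbs the final 1 in the value of `r` into the half, so that comparison with r = ½ (2 r)
-- becomes an equation between integers.
½ℤ-+1 : ∀ i → ½ℤ i ℚ.+ ℚ.1ℚ ≡ ½ℤ (i + + 2)
½ℤ-+1 i = sym (trans (cong (½ ℚ.*_) i+2/1) (ℚₚ.*-distribˡ-+ ½ (i / 1) (+ 2 / 1)))
  where
  i+2/1 : (i + + 2) / 1 ≡ i / 1 ℚ.+ + 2 / 1
  i+2/1 = ℚₚ.toℚᵘ-injective (begin
    ℚ.toℚᵘ ((i + + 2) / 1)                 ≈⟨ ℚₚ.toℚᵘ-fromℚᵘ (mkℚᵘ (i + + 2) 0) ⟩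
    mkℚᵘ (i + + 2) 0                       ≡⟨ cong (λ j → mkℚᵘ (j + + 2) 0) (ℤₚ.*-identityʳ i) ⟨
    mkℚᵘ i 0 ℚᵘ.+ mkℚᵘ (+ 2) 0             ≈⟨ ℚᵘₚ.+-congˡ (mkℚᵘ (+ 2) 0) (ℚₚ.toℚᵘ-fromℚᵘ (mkℚᵘ i 0)) ⟨
    ℚ.toℚᵘ (i / 1) ℚᵘ.+ ℚ.toℚᵘ (+ 2 / 1)   ≈⟨ ℚₚ.toℚᵘ-homo-+ (i / 1) (+ 2 / 1) ⟨
    ℚ.toℚᵘ (i / 1 ℚ.+ + 2 / 1)             ∎)
    where open import Relation.Binary.Reasoning.Setoid ℚᵘₚ.≃-setoid

-- The sextic factors as P (P² + P - 1) (P³ + P² - P + 1), and with x = P - 1 these are the factors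
-- of `maximum`. Writing P as `suc x` avoids truncated subtraction.
bound≡maximum : ∀ x → let P = + suc x in
  P ^ 6 + + 2 * P ^ 5 - P ^ 4 - P ^ 3 + + 2 * P ^ 2 - P ≡ + maximum x (suc x)
bound≡maximum x = trans (factor (+ x)) (sym +maximum)
  where
  -- The ring solver does not recognise ℤ's _^_, so the powers are unfolded.
  factor : ∀ x → let P = 1ℤ + x; P² = P * (P * 1ℤ); P³ = P * P²; P⁴ = P * P³; P⁵ = P * P⁴ in
    P * P⁵ + + 2 * P⁵ - P⁴ - P³ + + 2 * P² - P
    ≡ P * (1ℤ + x * (P + + 2)) * (+ 2 + x * ((P + 1ℤ) * (P + 1ℤ)))
  factor = ℤ-Solver.solve-∀
  -- The embedding `+_` commutes with addition by computation; only products need `pos-*`.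
  +maximum : + maximum x (suc x) ≡
    + suc x * (1ℤ + + x * (+ suc x + + 2)) * (+ 2 + + x * ((+ suc x + 1ℤ) * (+ suc x + 1ℤ)))
  +maximum = trans (ℤₚ.pos-* (suc x ℕ.* (1 ℕ.+ x ℕ.* (suc x ℕ.+ 2))) _) (cong₂ _*_
    (trans (ℤₚ.pos-* (suc x) (1 ℕ.+ x ℕ.* (suc x ℕ.+ 2))) (cong (λ z → + suc x * (1ℤ + z)) (ℤₚ.pos-* x _)))
    (cong (_+_ (+ 2)) (trans (ℤₚ.pos-* x _) (cong (_*_ (+ x)) (ℤₚ.pos-* (suc x ℕ.+ 1) (suc x ℕ.+ 1))))))

extremal-q : ∀ x → let P = + suc x in P ^ 2 + P - + 1 ≡ + suc (x ℕ.* (suc x ℕ.+ 2))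
extremal-q x = trans (factor (+ x)) (cong (_+_ 1ℤ) (sym (ℤₚ.pos-* x _)))
  where
  factor : ∀ x → let P = 1ℤ + x in P * (P * 1ℤ) + P - + 1 ≡ 1ℤ + x * (P + + 2)
  factor = ℤ-Solver.solve-∀

extremal-2r : ∀ x → let P = + suc x in
  (P - + 1) * (P + + 1) ^ 2 + + 2 ≡ + (2 ℕ.+ x ℕ.* ((suc x ℕ.+ 1) ℕ.* (suc x ℕ.+ 1)))
extremal-2r x = trans (factor (+ x)) (cong (_+_ (+ 2)) (sym
  (trans (ℤₚ.pos-* x _) (cong (_*_ (+ x)) (ℤₚ.pos-* (suc x ℕ.+ 1) (suc x ℕ.+ 1))))))
  where
  factor : ∀ x → let P = 1ℤ + x in
    (P - + 1) * ((P + + 1) * ((P + + 1) * 1ℤ)) + + 2 ≡ + 2 + x * ((P + 1ℤ) * (P + 1ℤ))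
  factor = ℤ-Solver.solve-∀

-- `P` is a variable here, so that P = `suc x` can be matched with `refl`; for a Korselt number it
-- is a product, and x is P - 1.
ℕ-maximum⇒bound : ∀ {n x P q r} → P ≡ suc x → 2 ℕ.* n ℕ.≤ maximum x P →
  (2 ℕ.* n ≡ maximum x P → q ≡ 1 ℕ.+ x ℕ.* (P ℕ.+ 2) × 2 ℕ.* r ≡ 2 ℕ.+ x ℕ.* ((P ℕ.+ 1) ℕ.* (P ℕ.+ 1))) →
  (q ≡ 1 ℕ.+ x ℕ.* (P ℕ.+ 2) → 2 ℕ.* r ≡ 2 ℕ.+ x ℕ.* ((P ℕ.+ 1) ℕ.* (P ℕ.+ 1)) → 2 ℕ.* n ≡ maximum x P) →
  let p = + P
      bound = ½ℤ (p ^ 6 + + 2 * p ^ 5 - p ^ 4 - p ^ 3 + + 2 * p ^ 2 - p)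
  in (+ n / 1 ℚ.≤ bound)
     × (+ n / 1 ≡ bound
        ⇔ (+ q ≡ p ^ 2 + p - + 1
           × + r / 1 ≡ ½ℤ ((p - + 1) * (p + + 1) ^ 2) ℚ.+ ℚ.1ℚ))
ℕ-maximum⇒bound {n} {x} {_} {q} {r} refl 2n≤ ⇒ ⇐ =
  subst₂ ℚ._≤_ (½ℤ-double n) (sym bound≡) (½ℤ-mono-≤ (ℤ.+≤+ 2n≤)) , mk⇔ to from
  where
  bound≡ = cong ½ℤ (bound≡maximum x)
  r-value≡ = trans (½ℤ-+1 ((+ suc x - + 1) * ((+ suc x + + 1) ^ 2))) (cong ½ℤ (extremal-2r x))
  to : _ → _
  to n≡ = map
    (λ q≡ → trans (cong +_ q≡) (sym (extremal-q x)))
    (λ 2r≡ → trans (sym (½ℤ-double r)) (trans (cong (½ℤ ∘ +_) 2r≡) (sym r-value≡)))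
    (⇒ (ℤₚ.+-injective (½ℤ-injective (trans (½ℤ-double n) (trans n≡ bound≡)))))
  from : _ → _
  from (q≡ , r≡) = trans (sym (½ℤ-double n)) (trans (cong (½ℤ ∘ +_) (⇐
    (ℤₚ.+-injective (trans q≡ (extremal-q x)))
    (ℤₚ.+-injective (½ℤ-injective (trans (½ℤ-double r) (trans r≡ r-value≡)))))) (sym bound≡))

theorem3p3 : ∀ (n : ℕ) (K : KorseltNumber n) →
  let P : ℤ
      P = + KorseltNumber.P K
      q : ℤ
      q = + KorseltNumber.q K
      r : ℤ
      r = + KorseltNumber.r K
      bound : ℚ
      bound = ½ ℚ.* ((P ^ 6 + + 2 * P ^ 5 - P ^ 4 - P ^ 3 + + 2 * P ^ 2 - P) / 1)
  in ((+ n) / 1 ℚ.≤ bound)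
     × ((+ n) / 1 ≡ bound
        ⇔ (q ≡ P ^ 2 + P - + 1
           × r / 1 ≡ ½ ℚ.* (((P - + 1) * (P + + 1) ^ 2) / 1) ℚ.+ ℚ.1ℚ))
theorem3p3 n K = ℕ-maximum⇒bound {n} {_} {KorseltNumber.P K} {KorseltNumber.q K} {KorseltNumber.r K}
  (sym (m+[n∸m]≡n (<⇒≤ (P>1 K))))
  (2n≤maximum K) (2n≡maximum⇒ K) (2n≡maximum⇐ K)
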